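{- Let $t, r$ be integers with $1 \leq t \leq r$, let $k$ be a positive integer, and let $\mathcal{H}$ be a hereditary family with $\mu(\mathcal{H}) \geq n_{\rm S}(r,t)$. Let $\emptyset \neq S \subseteq [t,r]$ and $\mathcal{F} := \bigcup_{s \in S}\mathcal{H}^{(s)}$. Let $\mathcal{A}_1, \dots, \mathcal{A}_k$ be cross-$t$-intersecting subfamilies of $\mathcal{F}$, and let $\mathcal{L}$ be a largest $t$-star of $\mathcal{F}$. Then \[\sum_{i = 1}^k |\mathcal{A}_i| \leq \max\left\{ k|\mathcal{L}|, |\mathcal{F}| \right\}.\] Moreover, equality holds if and only if one of the following holds: (i) $|\mathcal{F}| < k|\mathcal{L}|$ and $\mathcal{A}_1 = \dots = \mathcal{A}_k = \mathcal{L}'$ for some largest $t$-star $\mathcal{L}'$ of $\mathcal{F}$; (ii) $|\mathcal{F}| > k |\mathcal{L}|$ and, for some $j \in [k]$, $\mathcal{A}_j = \mathcal{F}$ and $\mathcal{A}_i = \emptyset$ for all $i \in [k] \setminus \{j\}$; (iii) $|\mathcal{F}| = k |\mathcal{L}|$, and $\mathcal{A}_1, \dots, \mathcal{A}_k$ are as in (i) or (ii).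
   Context: All sets and families are finite; a family is a set of sets. For integers $m \le n$, $[m,n] := \{i \in \{1,2,\dots\} : m \le i \le n\}$ and $[n] := [1,n]$. A family $\mathcal{H}$ is hereditary if every subset of every member of $\mathcal{H}$ is a member of $\mathcal{H}$. A base of a family $\mathcal{F}$ is a set $B \in \mathcal{F}$ that is not a proper subset of any member of $\mathcal{F}$; $\mu(\mathcal{F})$ denotes the size of a smallest base of $\mathcal{F}$. For a family $\mathcal{F}$, $\mathcal{F}^{(s)} := \{F \in \mathcal{F} : |F| = s\}$. For a set $T$, $\mathcal{F}\langle T\rangle := \{F \in \mathcal{F} : T \subseteq F\}$; this is called a $t$-star of $\mathcal{F}$ if $|T| = t$, and a largest $t$-star of $\mathcal{F}$ is a $t$-star of $\mathcal{F}$ of maximum size among all $t$-stars of $\mathcal{F}$. A set $A$ $t$-intersects a set $B$ if $|A \cap B| \geq t$. Families $\mathcal{A}_1,\dots,\mathcal{A}_k$ are cross-$t$-intersecting if for all distinct $i,j \in [k]$, every set in $\mathcal{A}_i$ $t$-intersects every set in $\mathcal{A}_j$ (families may be empty or equal). Define $m(r,t) := \max\{2r, \frac{(r-t)(r-t+5)}{2} + (t-1)\}$ and $n_{\rm S}(r,t) := (r-t+1)\binom{m(r,t)}{t+1} + r$. -}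

module Defs where

open import Data.Bool using (Bool; true; false; _∧_; if_then_else_)
open import Data.Nat using (ℕ; zero; suc; _+_; _*_; _∸_; _≤_; _<_; _⊔_; _/_)
open import Data.Nat.Combinatorics using (_C_)
open import Data.Fin using (Fin)
open import Data.Fin.Subset using (Subset; _⊆_; _∩_; ∣_∣; inside; outside; ⊥)
open import Data.Fin.Subset.Properties using (_⊆?_)
open import Data.List using (List; []; _∷_; _++_; map; length; filter; allFin)
open import Data.Nat.ListAction using () renaming (sum to lsum)
open import Data.Vec using ([]; _∷_)
open import Data.Product using (Σ; _×_; ∃)
open import Relation.Nullary using (¬_; does)
open import Relation.Binary.PropositionalEquality using (_≡_; _≢_)

-- Sets are subsets of a finite ground set Fin n (every finite family can be
-- relabelled into such a ground set).  A family of such sets is given by its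
-- characteristic (Boolean) function.
Family : ℕ → Set
Family n = Subset n → Bool

allSubsets : (n : ℕ) → List (Subset n)
allSubsets zero    = [] ∷ []
allSubsets (suc n) = map (inside ∷_) (allSubsets n) ++ map (outside ∷_) (allSubsets n)

card : {n : ℕ} → Family n → ℕ
card {n} 𝓕 = length (filter (λ X → 𝓕 X Data.Bool.≟ true) (allSubsets n))

_∈F_ : {n : ℕ} → Subset n → Family n → Set
X ∈F 𝓕 = 𝓕 X ≡ true

_≐_ : {n : ℕ} → Family n → Family n → Set
𝓐 ≐ 𝓑 = ∀ X → 𝓐 X ≡ 𝓑 X

emptyFamily : {n : ℕ} → Family n
emptyFamily _ = false

_⊑_ : {n : ℕ} → Family n → Family n → Set
𝓐 ⊑ 𝓑 = ∀ X → X ∈F 𝓐 → X ∈F 𝓑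

Hereditary : {n : ℕ} → Family n → Set
Hereditary 𝓗 = ∀ A B → A ⊆ B → B ∈F 𝓗 → A ∈F 𝓗

IsBase : {n : ℕ} → Family n → Subset n → Set
IsBase 𝓕 B = B ∈F 𝓕 × (∀ C → C ∈F 𝓕 → B ⊆ C → B ≡ C)

-- μ(𝓕) ≥ N : every base (hence a smallest one) has size at least N.
μ≥ : {n : ℕ} → Family n → ℕ → Set
μ≥ 𝓕 N = ∀ B → IsBase 𝓕 B → N ≤ ∣ B ∣

star : {n : ℕ} → Family n → Subset n → Family n
star 𝓕 T X = 𝓕 X ∧ does (T ⊆? X)

IsLargestStar : {n : ℕ} → ℕ → Family n → Subset n → Set
IsLargestStar t 𝓕 T =
  ∣ T ∣ ≡ t × (∀ T′ → ∣ T′ ∣ ≡ t → card (star 𝓕 T′) ≤ card (star 𝓕 T))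

unionLevels : {n : ℕ} → Family n → (ℕ → Bool) → Family n
unionLevels 𝓗 S X = 𝓗 X ∧ S ∣ X ∣

CrossTIntersecting : {n k : ℕ} → ℕ → (Fin k → Family n) → Set
CrossTIntersecting t 𝓐 =
  ∀ i j → i ≢ j → ∀ X Y → X ∈F 𝓐 i → Y ∈F 𝓐 j → t ≤ ∣ X ∩ Y ∣

-- m(r,t) and n_S(r,t); (r-t)(r-t+5) is always even so / 2 is exact.
mRT : ℕ → ℕ → ℕ
mRT r t = (2 * r) ⊔ (((r ∸ t) * (r ∸ t + 5)) / 2 + (t ∸ 1))

nS : ℕ → ℕ → ℕ
nS r t = (r ∸ t + 1) * (mRT r t C (t + 1)) + r

sumCard : {n k : ℕ} → (Fin k → Family n) → ℕ
sumCard {k = k} 𝓐 = lsum (map (λ i → card (𝓐 i)) (allFin k))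

AllEqualLargestStar : {n k : ℕ} → ℕ → Family n → (Fin k → Family n) → Set
AllEqualLargestStar {n} t 𝓕 𝓐 =
  Σ (Subset n) λ T′ → IsLargestStar t 𝓕 T′ × (∀ i → 𝓐 i ≐ star 𝓕 T′)

OneFullRestEmpty : {n k : ℕ} → Family n → (Fin k → Family n) → Set
OneFullRestEmpty {k = k} 𝓕 𝓐 =
  Σ (Fin k) λ j → 𝓐 j ≐ 𝓕 × (∀ i → i ≢ j → 𝓐 i ≐ emptyFamily)

{-# OPTIONS --safe #-}
module Submission where

-- Put 𝓕 = ⋃_{s ∈ S} 𝓗⁽ˢ⁾ with largest t-star of size ℓ, d = r - t and D = (d + 1) C(m(r,t), t + 1) + 1.
-- Every member of 𝓗 lies in a base, so a member of 𝓕 with one element removed can be completed to a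
-- member of the same size in at least D ways.  Double counting then shows that each (t + 1)-star has at
-- most d ℓ / D members and that ℓ ≤ r |𝓕| / D.
--
-- Let 𝓤 be the union of the 𝓐ᵢ and 𝓦 the family of the sets lying in at least two of them, so that
-- Σ |𝓐ᵢ| ≤ k |𝓦| + |𝓤| and every member of 𝓦 t-intersects every member of 𝓤.  Suppose that two of the
-- 𝓐ᵢ are nonempty and that 𝓤 lies in no t-star.  If X ∈ 𝓦, then |𝓤| ≤ C(r,t) ℓ, because each member of
-- 𝓤 contains a t-subset T′ of X; and the members of 𝓦 containing T′ meet Y \ T′ for some Y ∈ 𝓤 with
-- T′ ⊈ Y, whence |𝓦| ≤ C(r,t) r d ℓ / D.  If 𝓦 = ∅, then d ≥ 1 and |𝓤| ≤ 2 C(r,t) ℓ.  Either way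
-- r C(r,t) ≤ C(2r, t + 1) makes Σ |𝓐ᵢ| strictly less than max {k ℓ, |𝓕|}.

open import Defs
open import Data.Bool using (Bool; true; false; _∧_; if_then_else_)
import Data.Bool as Bool
open import Data.Bool.Properties using (∧-conicalˡ; ∧-conicalʳ; ¬-not)
open import Data.Nat hiding (∣_-_∣)
open import Data.Nat.Properties
open import Data.Nat.Combinatorics using (_C_; nCk+nC[k+1]≡[n+1]C[k+1])
open import Data.Nat.ListAction using () renaming (sum to lsum)
open import Data.Nat.Tactic.RingSolver using (solve-∀)
open import Data.Fin using (Fin; zero; suc; fromℕ<)
import Data.Fin.Properties as Fin
open import Data.Fin.Subset
  using (Subset; inside; outside; _∈_; _∉_; _⊆_; _⊈_; _∩_; _∪_; _─_; _-_; _⊃_; ⁅_⁆; ∣_∣; ⊥)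
open import Data.Fin.Subset.Properties
open import Data.Fin.Subset.Induction using (⊃-wellFounded)
open import Data.List using (List; []; _∷_; _++_; map; length; filter; allFin)
open import Data.List.Properties using (map-tabulate; length-map; length-++; length-tabulate)
import Data.List.Membership.Propositional as List
open import Data.List.Membership.Propositional.Properties
open import Data.List.Relation.Unary.All using (lookup) renaming ([] to []ₐ)
open import Data.List.Relation.Unary.AllPairs using ([]; _∷_)
open import Data.List.Relation.Unary.Any using (here; there)
open import Data.List.Relation.Unary.Unique.Propositional using (Unique)
open import Data.List.Relation.Unary.Unique.Propositional.Properties using (map⁺; ++⁺; allFin⁺)
open import Data.Vec using ([]; _∷_; here; there)
open import Data.Vec.Properties using (≡-dec; ∷-injectiveʳ)
open import Data.Product using (Σ; _×_; _,_; ∃; ∃₂; proj₁; proj₂)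
open import Data.Sum using (_⊎_; inj₁; inj₂; [_,_]′)
open import Function using (_∘_; id)
open import Function.Bundles using (_⇔_; mk⇔)
open import Induction.WellFounded using (Acc; acc)
open import Relation.Nullary using (¬_; Dec; yes; no; does; contradiction; ¬?; _×-dec_)
open import Relation.Nullary.Decidable using (dec-true; decidable-stable)
open import Relation.Binary.PropositionalEquality
  using (_≡_; _≢_; refl; sym; trans; cong; cong₂; subst; subst₂)

private variable
  A B : Set
  n   : ℕ

-- Finite sums over lists.

∑ : List A → (A → ℕ) → ℕ
∑ xs f = lsum (map f xs)

χ : Bool → ℕ
χ b = if b then 1 else 0

χ≤ : ∀ {b m} → (b ≡ true → 1 ≤ m) → χ b ≤ m
χ≤ {false} _ = z≤n
χ≤ {true}  h = h refl

does-sound : {P : Set} (P? : Dec P) → does P? ≡ true → P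
does-sound (yes p) _ = p

∑-mono : {f g : A → ℕ} → (∀ x → f x ≤ g x) → ∀ xs → ∑ xs f ≤ ∑ xs g
∑-mono f≤g []       = z≤n
∑-mono f≤g (x ∷ xs) = +-mono-≤ (f≤g x) (∑-mono f≤g xs)

-- Since `f x ≤ g x` for every term, a deficit in one term cannot be made up by another. This
-- recovers termwise equality from equal totals when a bound is attained.
∑-squeeze : {f g : A → ℕ} → (∀ x → f x ≤ g x) → ∀ xs → ∑ xs g ≤ ∑ xs f →
            ∀ {x} → x List.∈ xs → g x ≤ f x
∑-squeeze {f = f} {g} f≤g (x ∷ xs) le (here refl) = +-cancelʳ-≤ (∑ xs f) (g x) (f x)
  (≤-trans (+-monoʳ-≤ (g x) (∑-mono f≤g xs)) le)
∑-squeeze {f = f} {g} f≤g (x ∷ xs) le (there x∈xs) = ∑-squeeze f≤g xs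
  (+-cancelˡ-≤ (f x) _ _ (≤-trans (+-monoˡ-≤ (∑ xs g) (f≤g x)) le)) x∈xs

∑-+ : ∀ (f g : A → ℕ) xs → ∑ xs (λ x → f x + g x) ≡ ∑ xs f + ∑ xs g
∑-+ f g []       = refl
∑-+ f g (x ∷ xs) = trans (cong (f x + g x +_) (∑-+ f g xs)) (rearrange (f x) (g x) _ _)
  where
  rearrange : ∀ a b c d → a + b + (c + d) ≡ a + c + (b + d)
  rearrange = solve-∀

∑-* : ∀ c (f : A → ℕ) xs → ∑ xs (λ x → c * f x) ≡ c * ∑ xs f
∑-* c f []       = sym (*-zeroʳ c)
∑-* c f (x ∷ xs) = trans (cong (c * f x +_) (∑-* c f xs)) (sym (*-distribˡ-+ c (f x) _))

∑-const : ∀ c (xs : List A) → ∑ xs (λ _ → c) ≡ length xs * c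
∑-const c []       = refl
∑-const c (x ∷ xs) = cong (c +_) (∑-const c xs)

∑-swap : ∀ (f : A → B → ℕ) xs ys → ∑ xs (λ x → ∑ ys (f x)) ≡ ∑ ys (λ y → ∑ xs (λ x → f x y))
∑-swap f []       ys = sym (trans (∑-const 0 ys) (*-zeroʳ (length ys)))
∑-swap f (x ∷ xs) ys = trans (cong (∑ ys (f x) +_) (∑-swap f xs ys)) (sym (∑-+ (f x) _ ys))

term≤∑ : ∀ (f : A → ℕ) {x xs} → x List.∈ xs → f x ≤ ∑ xs f
term≤∑ f (here refl)          = m≤m+n _ _
term≤∑ f (there {y} x∈xs) = ≤-trans (term≤∑ f x∈xs) (m≤n+m _ (f y))

∑-zero : ∀ (f : A → ℕ) xs → (∀ {x} → x List.∈ xs → f x ≡ 0) → ∑ xs f ≡ 0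
∑-zero f []       h = refl
∑-zero f (x ∷ xs) h = cong₂ _+_ (h (here refl)) (∑-zero f xs (h ∘ there))

∑-χ≤1 : ∀ (p : A → Bool) {xs} → Unique xs → (∀ x y → p x ≡ true → p y ≡ true → x ≡ y) →
        ∑ xs (χ ∘ p) ≤ 1
∑-χ≤1 p []         uniq = z≤n
∑-χ≤1 p {x ∷ xs} (x∉xs ∷ u) uniq with p x in px
... | false = ∑-χ≤1 p u uniq
... | true  = ≤-reflexive (cong suc (∑-zero (χ ∘ p) xs others))
  where
  others : ∀ {y} → y List.∈ xs → χ (p y) ≡ 0
  others {y} y∈xs with p y in py
  ... | false = refl
  ... | true  = contradiction (uniq x y px py) (lookup x∉xs y∈xs)

∑-≤ : ∀ {f : A → ℕ} {c} xs → (∀ {x} → x List.∈ xs → f x ≤ c) → ∑ xs f ≤ length xs * c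
∑-≤ []       f≤c = z≤n
∑-≤ (x ∷ xs) f≤c = +-mono-≤ (f≤c (here refl)) (∑-≤ xs (f≤c ∘ there))

∑-single : ∀ {f : A → ℕ} {x xs} → Unique xs → x List.∈ xs → (∀ y → y ≢ x → f y ≡ 0) → ∑ xs f ≡ f x
∑-single {f = f} {x} {_ ∷ xs} (x∉xs ∷ u) (here refl) others = trans
  (cong (f x +_) (∑-zero f xs (λ y∈xs → others _ λ { refl → lookup x∉xs y∈xs refl })))
  (+-identityʳ (f x))
∑-single {f = f} {x} {y ∷ xs} (y∉xs ∷ u) (there x∈xs) others =
  cong₂ _+_ (others y (lookup y∉xs x∈xs)) (∑-single u x∈xs others)

length-allFin : ∀ k → length (allFin k) ≡ k
length-allFin k = length-tabulate id

∑-allFin-suc : ∀ (f : Fin (suc n) → ℕ) → ∑ (allFin (suc n)) f ≡ f zero + ∑ (allFin n) (f ∘ suc)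
∑-allFin-suc f = cong (λ ys → f zero + lsum ys)
  (trans (map-tabulate suc f) (sym (map-tabulate id (f ∘ suc))))

-- Cardinalities of sets and families as sums of indicators.

∣p∣≡∑ : ∀ (p : Subset n) → ∣ p ∣ ≡ ∑ (allFin n) (λ x → χ (does (x ∈? p)))
∣p∣≡∑ []            = refl
∣p∣≡∑ (outside ∷ p) = trans (∣p∣≡∑ p) (sym (∑-allFin-suc λ x → χ (does (x ∈? outside ∷ p))))
∣p∣≡∑ (inside ∷ p)  =
  trans (cong suc (∣p∣≡∑ p)) (sym (∑-allFin-suc λ x → χ (does (x ∈? inside ∷ p))))

∈-allSubsets : ∀ (X : Subset n) → X List.∈ allSubsets n
∈-allSubsets []            = here refl
∈-allSubsets (inside ∷ X)  = ∈-++⁺ˡ (∈-map⁺ (inside ∷_) (∈-allSubsets X))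
∈-allSubsets (outside ∷ X) = ∈-++⁺ʳ _ (∈-map⁺ (outside ∷_) (∈-allSubsets X))

allSubsets-unique : ∀ n → Unique (allSubsets n)
allSubsets-unique zero    = []ₐ ∷ []
allSubsets-unique (suc n) = ++⁺ (map⁺ ∷-injectiveʳ (allSubsets-unique n))
  (map⁺ ∷-injectiveʳ (allSubsets-unique n)) disjoint
  where
  disjoint : ∀ {X} → ¬ (X List.∈ map (inside ∷_) (allSubsets n) ×
                        X List.∈ map (outside ∷_) (allSubsets n))
  disjoint (X∈₁ , X∈₂) with ∈-map⁻ (inside ∷_) X∈₁ | ∈-map⁻ (outside ∷_) X∈₂
  ... | _ , _ , refl | _ , _ , ()

card≡∑ : ∀ (𝓕 : Family n) → card 𝓕 ≡ ∑ (allSubsets n) (χ ∘ 𝓕)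
card≡∑ {n} 𝓕 = go (allSubsets n)
  where
  go : ∀ Xs → length (filter (λ X → 𝓕 X Bool.≟ true) Xs) ≡ ∑ Xs (χ ∘ 𝓕)
  go []       = refl
  go (X ∷ Xs) with 𝓕 X
  ... | true  = cong suc (go Xs)
  ... | false = go Xs

χ-mono : ∀ {b c} → (b ≡ true → c ≡ true) → χ b ≤ χ c
χ-mono h = χ≤ (λ b≡t → ≤-reflexive (sym (cong χ (h b≡t))))

card-mono : {𝓐 𝓑 : Family n} → 𝓐 ⊑ 𝓑 → card 𝓐 ≤ card 𝓑
card-mono {n} {𝓐} {𝓑} 𝓐⊑𝓑 rewrite card≡∑ 𝓐 | card≡∑ 𝓑 = ∑-mono (χ-mono ∘ 𝓐⊑𝓑) (allSubsets n)

⊑-antisym : {𝓐 𝓑 : Family n} → 𝓐 ⊑ 𝓑 → 𝓑 ⊑ 𝓐 → 𝓐 ≐ 𝓑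
⊑-antisym {𝓐 = 𝓐} {𝓑} 𝓐⊑𝓑 𝓑⊑𝓐 X with 𝓐 X in a | 𝓑 X in b
... | true  | true  = refl
... | false | false = refl
... | true  | false = trans (sym (𝓐⊑𝓑 X a)) b
... | false | true  = trans (sym a) (𝓑⊑𝓐 X b)

card-cong : {𝓐 𝓑 : Family n} → 𝓐 ≐ 𝓑 → card 𝓐 ≡ card 𝓑
card-cong 𝓐≐𝓑 = ≤-antisym (card-mono (λ X → trans (sym (𝓐≐𝓑 X)))) (card-mono (λ X → trans (𝓐≐𝓑 X)))

⊑∧card≥⇒≐ : {𝓐 𝓑 : Family n} → 𝓐 ⊑ 𝓑 → card 𝓑 ≤ card 𝓐 → 𝓐 ≐ 𝓑
⊑∧card≥⇒≐ {n} {𝓐} {𝓑} 𝓐⊑𝓑 le = ⊑-antisym 𝓐⊑𝓑 λ X 𝓑X → χ-reflects _ _ (χ𝓑≤χ𝓐 X) 𝓑X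
  where
  χ𝓑≤χ𝓐 : ∀ X → χ (𝓑 X) ≤ χ (𝓐 X)
  χ𝓑≤χ𝓐 X = ∑-squeeze (χ-mono ∘ 𝓐⊑𝓑) (allSubsets n)
    (subst₂ _≤_ (card≡∑ 𝓑) (card≡∑ 𝓐) le) (∈-allSubsets X)
  χ-reflects : ∀ b c → χ b ≤ χ c → b ≡ true → c ≡ true
  χ-reflects true true _ _ = refl

card-empty : card (emptyFamily {n}) ≡ 0
card-empty {n} = trans (card≡∑ {n} emptyFamily) (∑-zero _ (allSubsets n) (λ _ → refl))

∈⇒card>0 : ∀ (𝓕 : Family n) {X} → X ∈F 𝓕 → 0 < card 𝓕
∈⇒card>0 𝓕 {X} X∈𝓕 = subst₂ _≤_ (cong χ X∈𝓕) (sym (card≡∑ 𝓕)) (term≤∑ (χ ∘ 𝓕) (∈-allSubsets X))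

-- Union bound: each member of `𝓐` lies in at least one pair `(X , y)` with `X ∈F 𝓑 y`, and
-- interchanging the sums counts these pairs by `y`. The families `𝓑 y` may overlap and may reach
-- outside `𝓐`.
card-cover : ∀ (𝓐 : Family n) (ys : List B) (𝓑 : B → Family n) →
             (∀ X → X ∈F 𝓐 → ∃ λ y → y List.∈ ys × X ∈F 𝓑 y) →
             card 𝓐 ≤ ∑ ys (card ∘ 𝓑)
card-cover {n} 𝓐 ys 𝓑 cover = begin
  card 𝓐                                          ≡⟨ card≡∑ 𝓐 ⟩
  ∑ (allSubsets n) (χ ∘ 𝓐)                        ≤⟨ ∑-mono (χ≤ ∘ pointwise) (allSubsets n) ⟩
  ∑ (allSubsets n) (λ X → ∑ ys (λ y → χ (𝓑 y X))) ≡⟨ ∑-swap _ (allSubsets n) ys ⟩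
  ∑ ys (λ y → ∑ (allSubsets n) (χ ∘ 𝓑 y))         ≤⟨ ∑-mono (λ y → ≤-reflexive (sym (card≡∑ (𝓑 y)))) ys ⟩
  ∑ ys (card ∘ 𝓑)                                 ∎
  where
  open ≤-Reasoning
  pointwise : ∀ X → X ∈F 𝓐 → 1 ≤ ∑ ys (λ y → χ (𝓑 y X))
  pointwise X X∈𝓐 with cover X X∈𝓐
  ... | y , y∈ys , X∈𝓑y = subst (_≤ _) (cong χ X∈𝓑y) (term≤∑ (λ y → χ (𝓑 y X)) y∈ys)

_≟ₛ_ : (X Y : Subset n) → Dec (X ≡ Y)
_≟ₛ_ = ≡-dec Bool._≟_

-- `𝓐` is covered by the fibres of `φ`. The fibre over `Z` contains at most the set `ψ Z`, and it is
-- empty when `Z` is not in `𝓑`.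
card-injection : ∀ (𝓐 𝓑 : Family n) (φ ψ : Subset n → Subset n) →
                 (∀ X → X ∈F 𝓐 → φ X ∈F 𝓑 × ψ (φ X) ≡ X) → card 𝓐 ≤ card 𝓑
card-injection {n} 𝓐 𝓑 φ ψ h = begin
  card 𝓐                                             ≤⟨ card-cover 𝓐 (allSubsets n) fibre inFibre ⟩
  ∑ (allSubsets n) (card ∘ fibre)                    ≤⟨ ∑-mono fibre≤1 (allSubsets n) ⟩
  ∑ (allSubsets n) (χ ∘ 𝓑)                           ≡⟨ card≡∑ 𝓑 ⟨
  card 𝓑                                             ∎
  where
  open ≤-Reasoning
  fibre : Subset n → Family n
  fibre Z X = 𝓐 X ∧ does (φ X ≟ₛ Z)
  inFibre : ∀ X → X ∈F 𝓐 → ∃ λ Z → Z List.∈ allSubsets n × X ∈F fibre Z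
  inFibre X X∈𝓐 = φ X , ∈-allSubsets _ , cong₂ _∧_ X∈𝓐 (dec-true (φ X ≟ₛ φ X) refl)
  image : ∀ X Z → X ∈F fibre Z → φ X ≡ Z
  image X Z e = does-sound (φ X ≟ₛ Z) (∧-conicalʳ (𝓐 X) _ e)
  preimage : ∀ X Z → X ∈F fibre Z → X ≡ ψ Z
  preimage X Z e = trans (sym (proj₂ (h X (∧-conicalˡ _ _ e)))) (cong ψ (image X Z e))
  fibre≤1 : ∀ Z → card (fibre Z) ≤ χ (𝓑 Z)
  fibre≤1 Z with 𝓑 Z in 𝓑Z
  ... | true  = subst (_≤ 1) (sym (card≡∑ (fibre Z))) (∑-χ≤1 (fibre Z) (allSubsets-unique n)
                  (λ X Y e e′ → trans (preimage X Z e) (sym (preimage Y Z e′))))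
  ... | false = ≤-reflexive (trans (card-cong fibre≐∅) (card-empty {n}))
    where
    fibre≐∅ : fibre Z ≐ emptyFamily
    fibre≐∅ X with fibre Z X in e
    ... | false = refl
    ... | true with () ← trans (sym 𝓑Z) (subst (_∈F 𝓑) (image X Z e) (proj₁ (h X (∧-conicalˡ _ _ e))))

-- Cardinalities of differences and one-element extensions.

x∈p─q⇒x∉q : ∀ (p q : Subset n) {x} → x ∈ p ─ q → x ∉ q
x∈p─q⇒x∉q (_ ∷ p) (inside ∷ q) (there x∈p─q) (there x∈q) = x∈p─q⇒x∉q p q x∈p─q x∈q
x∈p─q⇒x∉q (_ ∷ p) (outside ∷ q) (there x∈p─q) (there x∈q) = x∈p─q⇒x∉q p q x∈p─q x∈q

∣p─q∣+∣p∩q∣≡∣p∣ : ∀ (p q : Subset n) → ∣ p ─ q ∣ + ∣ p ∩ q ∣ ≡ ∣ p ∣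
∣p─q∣+∣p∩q∣≡∣p∣ []            []            = refl
∣p─q∣+∣p∩q∣≡∣p∣ (outside ∷ p) (outside ∷ q) = ∣p─q∣+∣p∩q∣≡∣p∣ p q
∣p─q∣+∣p∩q∣≡∣p∣ (outside ∷ p) (inside ∷ q)  = ∣p─q∣+∣p∩q∣≡∣p∣ p q
∣p─q∣+∣p∩q∣≡∣p∣ (inside ∷ p)  (outside ∷ q) = cong suc (∣p─q∣+∣p∩q∣≡∣p∣ p q)
∣p─q∣+∣p∩q∣≡∣p∣ (inside ∷ p)  (inside ∷ q)  =
  trans (+-suc _ _) (cong suc (∣p─q∣+∣p∩q∣≡∣p∣ p q))

q⊆p⇒∣p─q∣+∣q∣≡∣p∣ : {p q : Subset n} → q ⊆ p → ∣ p ─ q ∣ + ∣ q ∣ ≡ ∣ p ∣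
q⊆p⇒∣p─q∣+∣q∣≡∣p∣ {p = p} {q} q⊆p = trans
  (cong (λ z → ∣ p ─ q ∣ + ∣ z ∣)
    (⊆-antisym (λ x∈q → x∈p∩q⁺ (q⊆p x∈q , x∈q)) (p∩q⊆q p q)))
  (∣p─q∣+∣p∩q∣≡∣p∣ p q)

x∈p⇒1+∣p-x∣≡∣p∣ : ∀ {p : Subset n} {x} → x ∈ p → suc ∣ p - x ∣ ≡ ∣ p ∣
x∈p⇒1+∣p-x∣≡∣p∣ {p = p} {x} x∈p = trans (+-comm 1 _) (trans
  (cong (∣ p - x ∣ +_) (sym (∣⁅x⁆∣≡1 x)))
  (q⊆p⇒∣p─q∣+∣q∣≡∣p∣ (λ y∈ → subst (_∈ p) (sym (x∈⁅y⁆⇒x≡y x y∈)) x∈p)))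

x∉p-x : ∀ (p : Subset n) x → x ∉ p - x
x∉p-x p x x∈ = x∈p─q⇒x∉q p ⁅ x ⁆ x∈ (x∈⁅x⁆ x)

x∉p⇒∣p∪⁅x⁆∣≡1+∣p∣ : ∀ {p : Subset n} {x} → x ∉ p → ∣ p ∪ ⁅ x ⁆ ∣ ≡ suc ∣ p ∣
x∉p⇒∣p∪⁅x⁆∣≡1+∣p∣ {p = p} {x} x∉p = trans (sym (x∈p⇒1+∣p-x∣≡∣p∣ (q⊆p∪q p ⁅ x ⁆ (x∈⁅x⁆ x))))
  (cong (suc ∘ ∣_∣) (p∪x-x≡p))
  where
  p∪x-x≡p : p ∪ ⁅ x ⁆ - x ≡ p
  p∪x-x≡p = ⊆-antisym
    (λ y∈ → [ id , (λ y∈x → contradiction y∈x (x∈p─q⇒x∉q (p ∪ ⁅ x ⁆) ⁅ x ⁆ y∈)) ]′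
              (x∈p∪q⁻ p ⁅ x ⁆ (p─q⊆p (p ∪ ⁅ x ⁆) ⁅ x ⁆ y∈)))
    (λ y∈p → x∈p∧x≢y⇒x∈p-y (p⊆p∪q ⁅ x ⁆ y∈p) λ { refl → x∉p y∈p })

p⊆q∧∣q∣≤∣p∣⇒q⊆p : {p q : Subset n} → p ⊆ q → ∣ q ∣ ≤ ∣ p ∣ → q ⊆ p
p⊆q∧∣q∣≤∣p∣⇒q⊆p {p = p} p⊆q le {x} x∈q with x ∈? p
... | yes x∈p = x∈p
... | no  x∉p = contradiction le (<⇒≱ (p⊂q⇒∣p∣<∣q∣ (p⊆q , x , x∈q , x∉p)))

p⊈q⇒∃ : ∀ {p q : Subset n} → p ⊈ q → ∃ λ x → x ∈ p × x ∉ q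
p⊈q⇒∃ {p = p} {q} p⊈q with Fin.any? (λ x → x ∈? p ×-dec ¬? (x ∈? q))
... | yes w = w
... | no ¬w = contradiction (λ {x} x∈p → decidable-stable (x ∈? q) (λ x∉q → ¬w (x , x∈p , x∉q))) p⊈q

∣p∣>0⇒Nonempty : ∀ {p : Subset n} → 0 < ∣ p ∣ → ∃ λ x → x ∈ p
∣p∣>0⇒Nonempty {n} {p} p>0 with p⊈q⇒∃ {p = p} {⊥}
  (λ p⊆⊥ → <⇒≱ p>0 (≤-trans (p⊆q⇒∣p∣≤∣q∣ p⊆⊥) (≤-reflexive (∣⊥∣≡0 n))))
... | x , x∈p , _ = x , x∈p

-- Bases, stars and the exchange of elements.

-- Passing to a strictly larger member as long as there is one must stop, because strict inclusion
-- on subsets of a finite set is well-founded upwards.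
⊆-base : ∀ (𝓗 : Family n) {X} → X ∈F 𝓗 → ∃ λ B → IsBase 𝓗 B × X ⊆ B
⊆-base 𝓗 {X} = go (⊃-wellFounded X)
  where
  go : ∀ {X} → Acc _⊃_ X → X ∈F 𝓗 → ∃ λ B → IsBase 𝓗 B × X ⊆ B
  go {X} (acc rec) X∈𝓗 with anySubset? (λ Y → (𝓗 Y Bool.≟ true) ×-dec (X ⊂? Y))
  ... | yes (Y , Y∈𝓗 , X⊂Y) with go (rec X⊂Y) Y∈𝓗
  ...   | B , B-base , Y⊆B = B , B-base , Y⊆B ∘ proj₁ X⊂Y
  go {X} (acc rec) X∈𝓗 | no ¬∃ = X , (X∈𝓗 , maximal) , id
    where
    maximal : ∀ Y → Y ∈F 𝓗 → X ⊆ Y → X ≡ Y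
    maximal Y Y∈𝓗 X⊆Y = ⊆-antisym X⊆Y λ {y} y∈Y →
      decidable-stable (y ∈? X) λ y∉X → ¬∃ (Y , Y∈𝓗 , X⊆Y , y , y∈Y , y∉X)

∈-star⁺ : ∀ {𝓕 : Family n} {T X} → X ∈F 𝓕 → T ⊆ X → X ∈F star 𝓕 T
∈-star⁺ {T = T} {X} X∈𝓕 T⊆X = cong₂ _∧_ X∈𝓕 (dec-true (T ⊆? X) T⊆X)

∈-star⁻ : ∀ {𝓕 : Family n} {T X} → X ∈F star 𝓕 T → X ∈F 𝓕 × T ⊆ X
∈-star⁻ {𝓕 = 𝓕} {T} {X} e = ∧-conicalˡ _ _ e , does-sound (T ⊆? X) (∧-conicalʳ (𝓕 X) _ e)

-- Double counting of the pairs (X , w) with X ⊇ U and (X - u) ∪ ⁅ w ⁆ in the family: such a pair is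
-- determined by w and Z = (X - u) ∪ ⁅ w ⁆ ⊇ T, because X = (Z - w) ∪ ⁅ u ⁆.
star-exchange : ∀ (𝓕 : Family n) {T U : Subset n} {u} (D e : ℕ) → T ⊆ U → u ∈ U → u ∉ T →
  (∀ X → X ∈F 𝓕 → u ∈ X → ∃ λ W → D ≤ ∣ W ∣ ×
           (∀ w → w ∈ W → w ∉ X - u × ((X - u) ∪ ⁅ w ⁆) ∈F 𝓕)) →
  (∀ Z → Z ∈F 𝓕 → T ⊆ Z → ∣ Z ─ T ∣ ≤ e) →
  D * card (star 𝓕 U) ≤ e * card (star 𝓕 T)
star-exchange {n} 𝓕 {T} {U} {u} D e T⊆U u∈U u∉T extend bounded = begin
  D * card (star 𝓕 U)                                      ≡⟨ cong (D *_) (card≡∑ (star 𝓕 U)) ⟩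
  D * ∑ (allSubsets n) (χ ∘ star 𝓕 U)                      ≡⟨ ∑-* D _ (allSubsets n) ⟨
  ∑ (allSubsets n) (λ X → D * χ (star 𝓕 U X))              ≤⟨ ∑-mono many (allSubsets n) ⟩
  ∑ (allSubsets n) (λ X → ∑ (allFin n) (λ w → χ (𝓟 w X)))  ≡⟨ ∑-swap _ (allSubsets n) (allFin n) ⟩
  ∑ (allFin n) (λ w → ∑ (allSubsets n) (χ ∘ 𝓟 w))          ≤⟨ ∑-mono exchange (allFin n) ⟩
  ∑ (allFin n) (λ w → ∑ (allSubsets n) (χ ∘ 𝓠 w))          ≡⟨ ∑-swap _ (allFin n) (allSubsets n) ⟩
  ∑ (allSubsets n) (λ Z → ∑ (allFin n) (λ w → χ (𝓠 w Z)))  ≤⟨ ∑-mono few (allSubsets n) ⟩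
  ∑ (allSubsets n) (λ Z → e * χ (star 𝓕 T Z))              ≡⟨ ∑-* e _ (allSubsets n) ⟩
  e * ∑ (allSubsets n) (χ ∘ star 𝓕 T)                      ≡⟨ cong (e *_) (card≡∑ (star 𝓕 T)) ⟨
  e * card (star 𝓕 T)                                      ∎
  where
  open ≤-Reasoning

  φ ψ : Fin n → Subset n → Subset n
  φ w X = (X - u) ∪ ⁅ w ⁆
  ψ w Z = (Z - w) ∪ ⁅ u ⁆

  -- The choice `w = u` is allowed and returns `X` itself. As `T ⊆ X - u`, the condition `w ∉ X - u`
  -- puts `w` outside `T`, so each `Z` is reached through at most `∣ Z ─ T ∣` values of `w`.
  𝓟 𝓠 : Fin n → Family n
  𝓟 w X = star 𝓕 U X ∧ (does (¬? (w ∈? X - u)) ∧ 𝓕 (φ w X))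
  𝓠 w Z = star 𝓕 T Z ∧ does (w ∈? Z ─ T)

  many : ∀ X → D * χ (star 𝓕 U X) ≤ ∑ (allFin n) (λ w → χ (𝓟 w X))
  many X with star 𝓕 U X in X∈
  ... | false = ≤-trans (≤-reflexive (*-zeroʳ D)) z≤n
  ... | true with ∈-star⁻ {𝓕 = 𝓕} {U} X∈
  ...   | X∈𝓕 , U⊆X with extend X X∈𝓕 (U⊆X u∈U)
  ...     | W , D≤∣W∣ , ext = begin
    D * 1                                    ≡⟨ *-identityʳ D ⟩
    D                                        ≤⟨ D≤∣W∣ ⟩
    ∣ W ∣                                    ≡⟨ ∣p∣≡∑ W ⟩
    ∑ (allFin n) (λ w → χ (does (w ∈? W)))   ≤⟨ ∑-mono (λ w → χ-mono (λ w∈W →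
        let w∉ , Z∈ = ext w (does-sound (w ∈? W) w∈W)
        in cong₂ _∧_ (dec-true (¬? (w ∈? X - u)) w∉) Z∈)) (allFin n) ⟩
    ∑ (allFin n) (λ w → χ (does (¬? (w ∈? X - u)) ∧ 𝓕 (φ w X))) ∎

  few : ∀ Z → ∑ (allFin n) (λ w → χ (𝓠 w Z)) ≤ e * χ (star 𝓕 T Z)
  few Z with star 𝓕 T Z in Z∈
  ... | false = ≤-trans (≤-reflexive (∑-zero _ (allFin n) (λ _ → refl))) z≤n
  ... | true with ∈-star⁻ {𝓕 = 𝓕} {T} Z∈
  ...   | Z∈𝓕 , T⊆Z = begin
    ∑ (allFin n) (λ w → χ (does (w ∈? Z ─ T)))  ≡⟨ ∣p∣≡∑ (Z ─ T) ⟨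
    ∣ Z ─ T ∣                                   ≤⟨ bounded Z Z∈𝓕 T⊆Z ⟩
    e                                           ≡⟨ *-identityʳ e ⟨
    e * 1                                       ∎

  exchange : ∀ w → ∑ (allSubsets n) (χ ∘ 𝓟 w) ≤ ∑ (allSubsets n) (χ ∘ 𝓠 w)
  exchange w = subst₂ _≤_ (card≡∑ (𝓟 w)) (card≡∑ (𝓠 w)) (card-injection (𝓟 w) (𝓠 w) (φ w) (ψ w) h)
    where
    h : ∀ X → X ∈F 𝓟 w → φ w X ∈F 𝓠 w × ψ w (φ w X) ≡ X
    h X X∈ = cong₂ _∧_ (∈-star⁺ {𝓕 = 𝓕} Z∈𝓕 T⊆Z)
               (dec-true (w ∈? φ w X ─ T) (x∈p∧x∉q⇒x∈p─q w∈Z (w∉X-u ∘ T⊆X-u)))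
             , ⊆-antisym to from
      where
      X∈⋆ = ∧-conicalˡ (star 𝓕 U X) _ X∈
      rest = ∧-conicalʳ (star 𝓕 U X) _ X∈
      w∉X-u = does-sound (¬? (w ∈? X - u)) (∧-conicalˡ _ _ rest)
      Z∈𝓕 = ∧-conicalʳ (does (¬? (w ∈? X - u))) _ rest
      U⊆X : U ⊆ X
      U⊆X = proj₂ (∈-star⁻ {𝓕 = 𝓕} {U} X∈⋆)
      T⊆X-u : T ⊆ X - u
      T⊆X-u x∈T = x∈p∧x≢y⇒x∈p-y (U⊆X (T⊆U x∈T)) λ { refl → u∉T x∈T }
      T⊆Z : T ⊆ φ w X
      T⊆Z = p⊆p∪q ⁅ w ⁆ ∘ T⊆X-u
      w∈Z : w ∈ φ w X
      w∈Z = q⊆p∪q (X - u) ⁅ w ⁆ (x∈⁅x⁆ w)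
      to : ψ w (φ w X) ⊆ X
      to y∈ with x∈p∪q⁻ (φ w X - w) ⁅ u ⁆ y∈
      ... | inj₂ y∈u = subst (_∈ X) (sym (x∈⁅y⁆⇒x≡y u y∈u)) (U⊆X u∈U)
      ... | inj₁ y∈Z-w with x∈p∪q⁻ (X - u) ⁅ w ⁆ (p─q⊆p (φ w X) ⁅ w ⁆ y∈Z-w)
      ...   | inj₁ y∈X-u = p─q⊆p X ⁅ u ⁆ y∈X-u
      ...   | inj₂ y∈w   = contradiction y∈w (x∈p─q⇒x∉q (φ w X) ⁅ w ⁆ y∈Z-w)
      from : X ⊆ ψ w (φ w X)
      from {y} y∈X with y Fin.≟ u
      ... | yes refl = q⊆p∪q (φ w X - w) ⁅ u ⁆ (x∈⁅x⁆ u)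
      ... | no  y≢u  = p⊆p∪q ⁅ u ⁆ (x∈p∧x≢y⇒x∈p-y (p⊆p∪q ⁅ w ⁆ y∈X-u) λ { refl → w∉X-u y∈X-u })
        where y∈X-u = x∈p∧x≢y⇒x∈p-y y∈X y≢u

-- The `k`-subsets of a set and binomial inequalities.

-- The recursion follows Pascal's rule: at an element of `X`, the sublists are those that take it
-- and those that leave it.
kSubsets : ℕ → Subset n → List (Subset n)
kSubsets zero    X             = ⊥ ∷ []
kSubsets (suc k) []            = []
kSubsets (suc k) (outside ∷ X) = map (outside ∷_) (kSubsets (suc k) X)
kSubsets (suc k) (inside ∷ X)  = map (inside ∷_) (kSubsets k X) ++ map (outside ∷_) (kSubsets (suc k) X)

length-kSubsets : ∀ k (X : Subset n) → length (kSubsets k X) ≡ ∣ X ∣ C k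
length-kSubsets zero    X             = sym (nC0≡1 ∣ X ∣)
  where
  nC0≡1 : ∀ m → m C 0 ≡ 1
  nC0≡1 zero    = refl
  nC0≡1 (suc m) = refl
length-kSubsets (suc k) []            = refl
length-kSubsets (suc k) (outside ∷ X) = trans (length-map _ (kSubsets (suc k) X)) (length-kSubsets (suc k) X)
length-kSubsets (suc k) (inside ∷ X)  = trans (length-++ (map (inside ∷_) (kSubsets k X)))
  (trans (cong₂ _+_ (trans (length-map _ (kSubsets k X)) (length-kSubsets k X))
                    (trans (length-map _ (kSubsets (suc k) X)) (length-kSubsets (suc k) X)))
         (nCk+nC[k+1]≡[n+1]C[k+1] ∣ X ∣ k))

∈-kSubsets⇒size : ∀ k (X : Subset n) {T} → T List.∈ kSubsets k X → ∣ T ∣ ≡ k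
∈-kSubsets⇒size {n} zero X (here refl) = ∣⊥∣≡0 n
∈-kSubsets⇒size (suc k) (outside ∷ X) T∈ with ∈-map⁻ (outside ∷_) T∈
... | _ , T′∈ , refl = ∈-kSubsets⇒size (suc k) X T′∈
∈-kSubsets⇒size (suc k) (inside ∷ X) T∈ with ∈-++⁻ (map (inside ∷_) (kSubsets k X)) T∈
... | inj₁ T∈₁ with ∈-map⁻ (inside ∷_) T∈₁
...   | _ , T′∈ , refl = cong suc (∈-kSubsets⇒size k X T′∈)
∈-kSubsets⇒size (suc k) (inside ∷ X) T∈ | inj₂ T∈₂ with ∈-map⁻ (outside ∷_) T∈₂
...   | _ , T′∈ , refl = ∈-kSubsets⇒size (suc k) X T′∈

-- `T` consists of the first `k` common elements. This turns `t`-intersection with a fixed `X` into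
-- a cover by the stars of the `t`-subsets of `X`.
kSubset-of-∩ : ∀ k (X Y : Subset n) → k ≤ ∣ X ∩ Y ∣ → ∃ λ T → T List.∈ kSubsets k X × T ⊆ Y
kSubset-of-∩ zero X Y _ = ⊥ , here refl , ⊥⊆
kSubset-of-∩ (suc k) [] [] ()
kSubset-of-∩ (suc k) (outside ∷ X) (_ ∷ Y) le with kSubset-of-∩ (suc k) X Y le
... | T , T∈ , T⊆Y = outside ∷ T , ∈-map⁺ (outside ∷_) T∈ , out⊆ T⊆Y
kSubset-of-∩ (suc k) (inside ∷ X) (outside ∷ Y) le with kSubset-of-∩ (suc k) X Y le
... | T , T∈ , T⊆Y = outside ∷ T , ∈-++⁺ʳ _ (∈-map⁺ (outside ∷_) T∈) , out⊆ T⊆Y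
kSubset-of-∩ (suc k) (inside ∷ X) (inside ∷ Y) (s≤s le) with kSubset-of-∩ k X Y le
... | T , T∈ , T⊆Y = inside ∷ T , ∈-++⁺ˡ (∈-map⁺ (inside ∷_) T∈) , in⊆in T⊆Y

C-suc-≤ : ∀ n k → n C k ≤ suc n C k
C-suc-≤ zero    zero    = ≤-refl
C-suc-≤ (suc n) zero    = ≤-refl
C-suc-≤ n       (suc k) = subst (n C suc k ≤_) (nCk+nC[k+1]≡[n+1]C[k+1] n k) (m≤n+m _ (n C k))

C-monoˡ-≤ : ∀ k {m n} → m ≤ n → m C k ≤ n C k
C-monoˡ-≤ k m≤n = go (≤⇒≤′ m≤n)
  where
  go : ∀ {m n} → m ≤′ n → m C k ≤ n C k
  go ≤′-refl               = ≤-refl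
  go (≤′-step {n} m≤n) = ≤-trans (go m≤n) (C-suc-≤ n k)

-- By Pascal's rule, each increase of the upper index from `j + n` adds `(j + n) C k`, which is at
-- least `n C k`.
j*nCk≤[j+n]C[1+k] : ∀ j n k → j * (n C k) ≤ (j + n) C suc k
j*nCk≤[j+n]C[1+k] zero    n k = z≤n
j*nCk≤[j+n]C[1+k] (suc j) n k = subst (suc j * (n C k) ≤_) (nCk+nC[k+1]≡[n+1]C[k+1] (j + n) k)
  (+-mono-≤ (C-monoˡ-≤ k (m≤n+m n j)) (j*nCk≤[j+n]C[1+k] j n k))

r*rCt≤mRTC[1+t] : ∀ r t → r * (r C t) ≤ mRT r t C (t + 1)
r*rCt≤mRTC[1+t] r t = begin
  r * (r C t)       ≤⟨ j*nCk≤[j+n]C[1+k] r r t ⟩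
  (r + r) C suc t   ≡⟨ cong₂ _C_ (cong (r +_) (sym (+-identityʳ r))) (+-comm 1 t) ⟩
  (2 * r) C (t + 1) ≤⟨ C-monoˡ-≤ (t + 1) (m≤m⊔n (2 * r) _) ⟩
  mRT r t C (t + 1) ∎
  where open ≤-Reasoning

-- Sizes of stars in levels of a hereditary family.

module Hereditary-levels
  {n : ℕ} (t r : ℕ) (1≤t : 1 ≤ t)
  (𝓗 : Family n) (hereditary : Hereditary 𝓗) (μ≥nS : μ≥ 𝓗 (nS r t))
  (S : ℕ → Bool) (S⊆[t,r] : ∀ s → S s ≡ true → t ≤ s × s ≤ r)
  (T : Subset n) (T-largest : IsLargestStar t (unionLevels 𝓗 S) T)
  where

  open ≤-Reasoning

  𝓕 : Family n
  𝓕 = unionLevels 𝓗 S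

  -- `b` bounds the number of `t`-subsets of a member of `𝓕`. A member with one element removed has
  -- at most `r - 1` elements, so a base containing the rest has at least `nS r t - (r - 1) = D`
  -- further elements.
  ℓ f d b D : ℕ
  ℓ = card (star 𝓕 T)
  f = card 𝓕
  d = r ∸ t
  b = r C t
  D = suc ((d + 1) * (mRT r t C (t + 1)))

  ∈𝓕⇒∈𝓗 : ∀ {X} → X ∈F 𝓕 → X ∈F 𝓗
  ∈𝓕⇒∈𝓗 = ∧-conicalˡ _ _

  ∈𝓕⇒level : ∀ {X} → X ∈F 𝓕 → S ∣ X ∣ ≡ true
  ∈𝓕⇒level {X} = ∧-conicalʳ (𝓗 X) _

  ∈𝓕⇒size≥t : ∀ {X} → X ∈F 𝓕 → t ≤ ∣ X ∣
  ∈𝓕⇒size≥t X∈𝓕 = proj₁ (S⊆[t,r] _ (∈𝓕⇒level X∈𝓕))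

  ∈𝓕⇒size≤r : ∀ {X} → X ∈F 𝓕 → ∣ X ∣ ≤ r
  ∈𝓕⇒size≤r X∈𝓕 = proj₂ (S⊆[t,r] _ (∈𝓕⇒level X∈𝓕))

  ℓ-max : ∀ T′ → ∣ T′ ∣ ≡ t → card (star 𝓕 T′) ≤ ℓ
  ℓ-max = proj₂ T-largest

  -- `X - u` lies in a base `B`. Adding any `w` of `B` outside `X - u` gives a subset of `B` of the
  -- same size as `X`, hence a member of `𝓗` on the same level and so of `𝓕`. In the other
  -- direction, a member containing `V` has at most `r ∸ ∣ V ∣` elements outside `V`.
  star-shrinks : ∀ {V U u} → V ⊆ U → u ∈ U → u ∉ V →
                 D * card (star 𝓕 U) ≤ (r ∸ ∣ V ∣) * card (star 𝓕 V)
  star-shrinks {V} {U} {u} V⊆U u∈U u∉V = star-exchange 𝓕 D (r ∸ ∣ V ∣) V⊆U u∈U u∉V extend bounded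
    where
    bounded : ∀ Z → Z ∈F 𝓕 → V ⊆ Z → ∣ Z ─ V ∣ ≤ r ∸ ∣ V ∣
    bounded Z Z∈𝓕 V⊆Z = m+n≤o⇒m≤o∸n ∣ Z ─ V ∣
      (≤-trans (≤-reflexive (q⊆p⇒∣p─q∣+∣q∣≡∣p∣ V⊆Z)) (∈𝓕⇒size≤r Z∈𝓕))
    extend : ∀ X → X ∈F 𝓕 → u ∈ X → ∃ λ W → D ≤ ∣ W ∣ ×
               (∀ w → w ∈ W → w ∉ X - u × ((X - u) ∪ ⁅ w ⁆) ∈F 𝓕)
    extend X X∈𝓕 u∈X with ⊆-base 𝓗 (hereditary (X - u) X (p─q⊆p X ⁅ u ⁆) (∈𝓕⇒∈𝓗 X∈𝓕))
    ... | B , B-base , X-u⊆B = B ─ (X - u) , +-cancelʳ-≤ ∣ X - u ∣ D _ large , exchanged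
      where
      large : D + ∣ X - u ∣ ≤ ∣ B ─ (X - u) ∣ + ∣ X - u ∣
      large = begin
        D + ∣ X - u ∣                                    ≡⟨ +-suc _ ∣ X - u ∣ ⟨
        (d + 1) * (mRT r t C (t + 1)) + suc ∣ X - u ∣    ≡⟨ cong (_ +_) (x∈p⇒1+∣p-x∣≡∣p∣ u∈X) ⟩
        (d + 1) * (mRT r t C (t + 1)) + ∣ X ∣            ≤⟨ +-monoʳ-≤ _ (∈𝓕⇒size≤r X∈𝓕) ⟩
        nS r t                                           ≤⟨ μ≥nS B B-base ⟩
        ∣ B ∣                                            ≡⟨ q⊆p⇒∣p─q∣+∣q∣≡∣p∣ X-u⊆B ⟨
        ∣ B ─ (X - u) ∣ + ∣ X - u ∣                      ∎
      exchanged : ∀ w → w ∈ B ─ (X - u) → w ∉ X - u × ((X - u) ∪ ⁅ w ⁆) ∈F 𝓕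
      exchanged w w∈ = w∉ , cong₂ _∧_
        (hereditary _ B (λ x∈ → [ X-u⊆B
                                , (λ x∈w → subst (_∈ B) (sym (x∈⁅y⁆⇒x≡y w x∈w)) (p─q⊆p B (X - u) w∈))
                                ]′ (x∈p∪q⁻ (X - u) ⁅ w ⁆ x∈))
                      (proj₁ B-base))
        (trans (cong S (trans (x∉p⇒∣p∪⁅x⁆∣≡1+∣p∣ w∉) (x∈p⇒1+∣p-x∣≡∣p∣ u∈X))) (∈𝓕⇒level X∈𝓕))
        where w∉ = x∈p─q⇒x∉q B (X - u) w∈

  -- As `1 ≤ t`, some `u` can be removed from `T`; the star of `T - u` is at least `D / r` times as
  -- large and is still part of `𝓕`.
  D*ℓ≤r*f : D * ℓ ≤ r * f
  D*ℓ≤r*f with ∣p∣>0⇒Nonempty (≤-trans 1≤t (≤-reflexive (sym (proj₁ T-largest))))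
  ... | u , u∈T = ≤-trans (star-shrinks (p─q⊆p T ⁅ u ⁆) u∈T (x∉p-x T u))
    (*-mono-≤ (m∸n≤m r ∣ T - u ∣)
              (card-mono {𝓐 = star 𝓕 (T - u)} (λ X → proj₁ ∘ ∈-star⁻ {𝓕 = 𝓕} {T - u})))

  -- Every member of `𝓑` contains one of the at most `b` `t`-subsets of `X`. The factor `c` lets
  -- star bounds scaled by `D` be summed without division.
  cover-by-stars : ∀ c e (𝓑 : Family n) {X} → ∣ X ∣ ≤ r → (∀ Y → Y ∈F 𝓑 → t ≤ ∣ X ∩ Y ∣) →
                   (∀ T′ → ∣ T′ ∣ ≡ t → c * card (star 𝓑 T′) ≤ e) → c * card 𝓑 ≤ b * e
  cover-by-stars c e 𝓑 {X} ∣X∣≤r meets small = begin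
    c * card 𝓑
      ≤⟨ *-monoʳ-≤ c (card-cover 𝓑 (kSubsets t X) (star 𝓑) covered) ⟩
    c * ∑ (kSubsets t X) (card ∘ star 𝓑)                  ≡⟨ ∑-* c _ (kSubsets t X) ⟨
    ∑ (kSubsets t X) (λ T′ → c * card (star 𝓑 T′))
      ≤⟨ ∑-≤ (kSubsets t X) (λ {T′} → small T′ ∘ ∈-kSubsets⇒size t X) ⟩
    length (kSubsets t X) * e                             ≡⟨ cong (_* e) (length-kSubsets t X) ⟩
    (∣ X ∣ C t) * e                                       ≤⟨ *-monoˡ-≤ e (C-monoˡ-≤ t ∣X∣≤r) ⟩
    b * e                                                 ∎
    where
    covered : ∀ Y → Y ∈F 𝓑 → ∃ λ T′ → T′ List.∈ kSubsets t X × Y ∈F star 𝓑 T′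
    covered Y Y∈𝓑 with kSubset-of-∩ t X Y (meets Y Y∈𝓑)
    ... | T′ , T′∈ , T′⊆Y = T′ , T′∈ , ∈-star⁺ {𝓕 = 𝓑} Y∈𝓑 T′⊆Y

  star-mono : ∀ {𝓑 : Family n} → 𝓑 ⊑ 𝓕 → ∀ T′ → card (star 𝓑 T′) ≤ card (star 𝓕 T′)
  star-mono {𝓑} 𝓑⊑𝓕 T′ = card-mono {𝓐 = star 𝓑 T′} λ X X∈ →
    let X∈𝓑 , T′⊆X = ∈-star⁻ {𝓕 = 𝓑} {T′} X∈ in ∈-star⁺ {𝓕 = 𝓕} (𝓑⊑𝓕 X X∈𝓑) T′⊆X

  card≤b*ℓ : ∀ (𝓑 : Family n) {X} → 𝓑 ⊑ 𝓕 → ∣ X ∣ ≤ r → (∀ Y → Y ∈F 𝓑 → t ≤ ∣ X ∩ Y ∣) →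
             card 𝓑 ≤ b * ℓ
  card≤b*ℓ 𝓑 {X} 𝓑⊑𝓕 ∣X∣≤r meets = subst (_≤ b * ℓ) (*-identityˡ (card 𝓑))
    (cover-by-stars 1 ℓ 𝓑 {X} ∣X∣≤r meets λ T′ ∣T′∣≡t →
      ≤-trans (≤-reflexive (*-identityˡ _)) (≤-trans (star-mono 𝓑⊑𝓕 T′) (ℓ-max T′ ∣T′∣≡t)))

  -- Such an X ⊇ T′ meets Y outside T′: otherwise X ∩ Y ⊆ T′ would force T′ = X ∩ Y ⊆ Y.
  D*star≤r*[d*ℓ] : ∀ {𝓑 : Family n} {T′ Y} → 𝓑 ⊑ 𝓕 → ∣ T′ ∣ ≡ t → ∣ Y ∣ ≤ r → T′ ⊈ Y →
                   (∀ X → X ∈F 𝓑 → t ≤ ∣ X ∩ Y ∣) → D * card (star 𝓑 T′) ≤ r * (d * ℓ)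
  D*star≤r*[d*ℓ] {𝓑} {T′} {Y} 𝓑⊑𝓕 ∣T′∣≡t ∣Y∣≤r T′⊈Y meets = begin
    D * card (star 𝓑 T′)
      ≤⟨ *-monoʳ-≤ D (card-cover (star 𝓑 T′) (allFin n) 𝓠 covered) ⟩
    D * ∑ (allFin n) (card ∘ 𝓠)                                ≡⟨ ∑-* D _ (allFin n) ⟨
    ∑ (allFin n) (λ y → D * card (𝓠 y))                        ≤⟨ ∑-mono 𝓠-small (allFin n) ⟩
    ∑ (allFin n) (λ y → d * ℓ * χ (does (y ∈? Y ─ T′)))        ≡⟨ ∑-* (d * ℓ) _ (allFin n) ⟩
    d * ℓ * ∑ (allFin n) (λ y → χ (does (y ∈? Y ─ T′)))        ≡⟨ cong (d * ℓ *_) (∣p∣≡∑ (Y ─ T′)) ⟨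
    d * ℓ * ∣ Y ─ T′ ∣
      ≤⟨ *-monoʳ-≤ (d * ℓ) (≤-trans (∣p─q∣≤∣p∣ Y T′) ∣Y∣≤r) ⟩
    d * ℓ * r                                                  ≡⟨ *-comm (d * ℓ) r ⟩
    r * (d * ℓ)                                                ∎
    where
    -- The covering families are stars of `𝓕` rather than of `𝓑`, because the exchange bound is one
    -- for `𝓕`. Only the elements `y` of `Y ─ T′`, at most `r` of them, contribute.
    𝓠 : Fin n → Family n
    𝓠 y X = does (y ∈? Y ─ T′) ∧ star 𝓕 (T′ ∪ ⁅ y ⁆) X

    𝓠-small : ∀ y → D * card (𝓠 y) ≤ d * ℓ * χ (does (y ∈? Y ─ T′))
    𝓠-small y with y ∈? Y ─ T′
    ... | no _ = ≤-trans (≤-reflexive (trans (cong (D *_) (card-empty {n})) (*-zeroʳ D))) z≤n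
    ... | yes y∈ = begin
      D * card (star 𝓕 (T′ ∪ ⁅ y ⁆))
        ≤⟨ star-shrinks (p⊆p∪q ⁅ y ⁆) (q⊆p∪q T′ ⁅ y ⁆ (x∈⁅x⁆ y)) (x∈p─q⇒x∉q Y T′ y∈) ⟩
      (r ∸ ∣ T′ ∣) * card (star 𝓕 T′)        ≤⟨ *-mono-≤ (≤-reflexive (cong (r ∸_) ∣T′∣≡t)) (ℓ-max T′ ∣T′∣≡t) ⟩
      d * ℓ                                  ≡⟨ *-identityʳ (d * ℓ) ⟨
      d * ℓ * 1                              ∎

    covered : ∀ X → X ∈F star 𝓑 T′ → ∃ λ y → y List.∈ allFin n × X ∈F 𝓠 y
    covered X X∈⋆ with ∈-star⁻ {𝓕 = 𝓑} {T′} X∈⋆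
    ... | X∈𝓑 , T′⊆X with p⊈q⇒∃ {p = X ∩ Y} {T′} X∩Y⊈T′
      where
      X∩Y⊈T′ : X ∩ Y ⊈ T′
      X∩Y⊈T′ X∩Y⊆T′ = T′⊈Y (p∩q⊆q X Y ∘ p⊆q∧∣q∣≤∣p∣⇒q⊆p X∩Y⊆T′
        (≤-trans (≤-reflexive ∣T′∣≡t) (meets X X∈𝓑)))
    ...   | y , y∈X∩Y , y∉T′ = y , ∈-allFin y , cong₂ _∧_
      (dec-true (y ∈? Y ─ T′) (x∈p∧x∉q⇒x∈p─q (p∩q⊆q X Y y∈X∩Y) y∉T′))
      (∈-star⁺ {𝓕 = 𝓕} (𝓑⊑𝓕 X X∈𝓑) λ x∈ →
        [ T′⊆X , (λ x∈y → subst (_∈ X) (sym (x∈⁅y⁆⇒x≡y y x∈y)) (p∩q⊆p X Y y∈X∩Y)) ]′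
          (x∈p∪q⁻ T′ ⁅ y ⁆ x∈))

  -- The additional 1 in `D` makes the comparison strict, and with it the conclusion of `below-M`.
  [d+1]*[r*b]<D : (d + 1) * (r * b) < D
  [d+1]*[r*b]<D = s≤s (*-monoʳ-≤ (d + 1) (r*rCt≤mRTC[1+t] r t))

  -- Cross-`t`-intersecting families and the union of their members.

  module Cross-intersecting {k : ℕ} (𝓐 : Fin k → Family n) (𝓐⊑𝓕 : ∀ i → 𝓐 i ⊑ 𝓕)
    (cross : CrossTIntersecting t 𝓐) where

    M : ℕ
    M = (k * ℓ) ⊔ f

    InSome InTwo : Subset n → Set
    InSome X = ∃ λ i → X ∈F 𝓐 i
    InTwo X = ∃₂ λ i j → i ≢ j × X ∈F 𝓐 i × X ∈F 𝓐 j

    inSome? : ∀ X → Dec (InSome X)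
    inSome? X = Fin.any? λ i → 𝓐 i X Bool.≟ true

    inTwo? : ∀ X → Dec (InTwo X)
    inTwo? X = Fin.any? λ i → Fin.any? λ j →
      ¬? (i Fin.≟ j) ×-dec (𝓐 i X Bool.≟ true) ×-dec (𝓐 j X Bool.≟ true)

    𝓤 𝓦 : Family n
    𝓤 X = does (inSome? X)
    𝓦 X = does (inTwo? X)

    InSome⇒∈𝓕 : ∀ {X} → InSome X → X ∈F 𝓕
    InSome⇒∈𝓕 (i , X∈) = 𝓐⊑𝓕 i _ X∈

    InTwo⇒InSome : ∀ {X} → InTwo X → InSome X
    InTwo⇒InSome (i , _ , _ , X∈ , _) = i , X∈

    -- The index of a family containing `Z` differs from `i` or from `j`, so cross-intersection
    -- applies to `X` or to `Y`.
    meets-two : ∀ {i j X Y Z} → i ≢ j → X ∈F 𝓐 i → Y ∈F 𝓐 j → InSome Z → t ≤ ∣ X ∩ Z ∣ ⊎ t ≤ ∣ Y ∩ Z ∣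
    meets-two {i} {j} {X} {Y} {Z} i≢j X∈ Y∈ (l , Z∈) with l Fin.≟ i
    ... | no  l≢i  = inj₁ (cross i l (l≢i ∘ sym) X Z X∈ Z∈)
    ... | yes refl = inj₂ (cross j i (i≢j ∘ sym) Y Z Y∈ Z∈)

    InTwo-meets : ∀ {X Y} → InTwo X → InSome Y → t ≤ ∣ X ∩ Y ∣
    InTwo-meets (_ , _ , i≢j , X∈₁ , X∈₂) Y∈ = [ id , id ]′ (meets-two i≢j X∈₁ X∈₂ Y∈)

    -- A set lying in two of the families is counted at most `k` times in the sum, any other member
    -- of the union exactly once.
    sumCard≤ : sumCard 𝓐 ≤ k * card 𝓦 + card 𝓤
    sumCard≤ = begin
      ∑ (allFin k) (card ∘ 𝓐)
        ≤⟨ ∑-mono (≤-reflexive ∘ card≡∑ ∘ 𝓐) (allFin k) ⟩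
      ∑ (allFin k) (λ i → ∑ (allSubsets n) (χ ∘ 𝓐 i))                ≡⟨ ∑-swap _ (allFin k) (allSubsets n) ⟩
      ∑ (allSubsets n) (λ X → ∑ (allFin k) (λ i → χ (𝓐 i X)))        ≤⟨ ∑-mono multiplicity (allSubsets n) ⟩
      ∑ (allSubsets n) (λ X → k * χ (𝓦 X) + χ (𝓤 X))                 ≡⟨ ∑-+ _ (χ ∘ 𝓤) (allSubsets n) ⟩
      ∑ (allSubsets n) (λ X → k * χ (𝓦 X)) + ∑ (allSubsets n) (χ ∘ 𝓤)
        ≡⟨ cong₂ _+_ (∑-* k _ (allSubsets n)) (sym (card≡∑ 𝓤)) ⟩
      k * ∑ (allSubsets n) (χ ∘ 𝓦) + card 𝓤                          ≡⟨ cong (λ c → k * c + card 𝓤) (card≡∑ 𝓦) ⟨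
      k * card 𝓦 + card 𝓤                                            ∎
      where
      multiplicity : ∀ X → ∑ (allFin k) (λ i → χ (𝓐 i X)) ≤ k * χ (𝓦 X) + χ (𝓤 X)
      multiplicity X with inTwo? X | inSome? X
      ... | yes _ | s = begin
        ∑ (allFin k) (λ i → χ (𝓐 i X))   ≤⟨ ∑-≤ (allFin k) (λ {i} _ → χ≤ {𝓐 i X} (λ _ → ≤-refl)) ⟩
        length (allFin k) * 1            ≡⟨ cong (_* 1) (length-allFin k) ⟩
        k * 1                            ≤⟨ m≤m+n (k * 1) _ ⟩
        k * 1 + χ (does s)               ∎
      ... | no ¬two | yes _ = ≤-trans
        (∑-χ≤1 (λ i → 𝓐 i X) (allFin⁺ k) λ i j X∈i X∈j →
          decidable-stable (i Fin.≟ j) λ i≢j → ¬two (i , j , i≢j , X∈i , X∈j))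
        (m≤n+m 1 (k * 0))
      ... | no _ | no ¬one = ≤-trans
        (∑-≤ (allFin k) (λ {i} _ → χ≤ {𝓐 i X} {0} λ X∈ → contradiction (i , X∈) ¬one))
        (≤-trans (≤-reflexive (*-zeroʳ (length (allFin k)))) z≤n)

    below-M : ∀ {w a} → sumCard 𝓐 ≤ k * w + a → 0 < f →
              D * (k * w + a) ≤ (d + 1) * (r * b) * M → sumCard 𝓐 < M
    below-M {w} {a} sum≤ f>0 bound = *-cancelˡ-< D _ _ (begin-strict
      D * sumCard 𝓐           ≤⟨ *-monoʳ-≤ D sum≤ ⟩
      D * (k * w + a)         ≤⟨ bound ⟩
      (d + 1) * (r * b) * M   <⟨ *-monoˡ-< M {{>-nonZero (≤-trans f>0 (m≤n⊔m (k * ℓ) f))}} [d+1]*[r*b]<D ⟩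
      D * M                   ∎)

    -- Strict inequality when the union lies in no `t`-star.

    module _ (nonStar : ∀ T′ → ∣ T′ ∣ ≡ t → ∃ λ Y → InSome Y × T′ ⊈ Y) where

      𝓤⊑𝓕 : 𝓤 ⊑ 𝓕
      𝓤⊑𝓕 X = InSome⇒∈𝓕 ∘ does-sound (inSome? X)

      𝓦⊑𝓕 : 𝓦 ⊑ 𝓕
      𝓦⊑𝓕 X = InSome⇒∈𝓕 ∘ InTwo⇒InSome ∘ does-sound (inTwo? X)

      -- After multiplication by `D`, there are `d + 1` copies of `r * b * M` available: `d` of them
      -- pay for `k * card 𝓦` through `k * ℓ ≤ M`, the last one for `card 𝓤` through `D * ℓ ≤ r * f`
      -- and `f ≤ M`.
      sum<M-overlapping : ∀ {X} → InTwo X → sumCard 𝓐 < M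
      sum<M-overlapping {X} X∈ = below-M sumCard≤ (∈⇒card>0 𝓕 X∈𝓕) (begin
        D * (k * card 𝓦 + card 𝓤)                   ≡⟨ distribute D k (card 𝓦) (card 𝓤) ⟩
        k * (D * card 𝓦) + D * card 𝓤               ≤⟨ +-mono-≤ (*-monoʳ-≤ k 𝓦-bound) (*-monoʳ-≤ D 𝓤-bound) ⟩
        k * (b * (r * (d * ℓ))) + D * (b * ℓ)       ≡⟨ regroup k b r d ℓ D ⟩
        b * r * d * (k * ℓ) + b * (D * ℓ)           ≤⟨ +-mono-≤ (*-monoʳ-≤ (b * r * d) (m≤m⊔n (k * ℓ) f))
                                                               (*-monoʳ-≤ b (≤-trans D*ℓ≤r*f (*-monoʳ-≤ r (m≤n⊔m (k * ℓ) f)))) ⟩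
        b * r * d * M + b * (r * M)                 ≡⟨ collect b r d M ⟩
        (d + 1) * (r * b) * M                       ∎)
        where
        X∈𝓕 = InSome⇒∈𝓕 (InTwo⇒InSome X∈)

        𝓤-bound : card 𝓤 ≤ b * ℓ
        𝓤-bound = card≤b*ℓ 𝓤 {X} 𝓤⊑𝓕 (∈𝓕⇒size≤r X∈𝓕)
          (λ Y → InTwo-meets X∈ ∘ does-sound (inSome? Y))

        𝓦-bound : D * card 𝓦 ≤ b * (r * (d * ℓ))
        𝓦-bound = cover-by-stars D (r * (d * ℓ)) 𝓦 {X} (∈𝓕⇒size≤r X∈𝓕)
          (λ Y → InTwo-meets X∈ ∘ InTwo⇒InSome ∘ does-sound (inTwo? Y))
          λ T′ ∣T′∣≡t → let Y , Y∈ , T′⊈Y = nonStar T′ ∣T′∣≡t in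
            D*star≤r*[d*ℓ] 𝓦⊑𝓕 ∣T′∣≡t (∈𝓕⇒size≤r (InSome⇒∈𝓕 Y∈)) T′⊈Y
              (λ Z Z∈ → InTwo-meets (does-sound (inTwo? Z) Z∈) Y∈)

        distribute : ∀ D k w a → D * (k * w + a) ≡ k * (D * w) + D * a
        distribute = solve-∀
        regroup : ∀ k b r d ℓ D → k * (b * (r * (d * ℓ))) + D * (b * ℓ) ≡ b * r * d * (k * ℓ) + b * (D * ℓ)
        regroup = solve-∀
        collect : ∀ b r d M → b * r * d * M + b * (r * M) ≡ (d + 1) * (r * b) * M
        collect = solve-∀

      -- If `r ≤ t`, all members of `𝓕` have exactly `t` elements, so `t`-intersecting members
      -- coincide. Then `X` equals `Y` and is contained in every set of the union, against `nonStar`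
      -- for `X`.
      t<r : ∀ {i j X Y} → i ≢ j → X ∈F 𝓐 i → Y ∈F 𝓐 j → t < r
      t<r {i} {j} {X} {Y} i≢j X∈ Y∈ = ≰⇒> λ r≤t →
        let ∣X∣≤t = ≤-trans (∈𝓕⇒size≤r (𝓐⊑𝓕 i X X∈)) r≤t

            ⊆-meet : ∀ {Z} → t ≤ ∣ X ∩ Z ∣ → X ⊆ Z
            ⊆-meet {Z} t≤ = p∩q⊆q X Z ∘ p⊆q∧∣q∣≤∣p∣⇒q⊆p (p∩q⊆p X Z) (≤-trans ∣X∣≤t t≤)

            X⊆Y = ⊆-meet (cross i j i≢j X Y X∈ Y∈)

            Y⊆X : Y ⊆ X
            Y⊆X = p⊆q∧∣q∣≤∣p∣⇒q⊆p X⊆Y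
              (≤-trans (∈𝓕⇒size≤r (𝓐⊑𝓕 j Y Y∈)) (≤-trans r≤t (∈𝓕⇒size≥t (𝓐⊑𝓕 i X X∈))))

            Z , Z∈ , X⊈Z = nonStar X (≤-antisym ∣X∣≤t (∈𝓕⇒size≥t (𝓐⊑𝓕 i X X∈)))
        in X⊈Z (⊆-meet ([ id , subst (λ V → t ≤ ∣ V ∩ Z ∣) (⊆-antisym Y⊆X X⊆Y) ]′ (meets-two i≢j X∈ Y∈ Z∈)))

      -- Each set of the union `t`-intersects `X` or `Y`, which costs a factor 2. This is absorbed
      -- by `d + 1`, as `t < r`.
      sum<M-disjoint : ∀ {i j X Y} → (∀ Z → ¬ InTwo Z) → i ≢ j → X ∈F 𝓐 i → Y ∈F 𝓐 j → sumCard 𝓐 < M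
      sum<M-disjoint {i} {j} {X} {Y} disjoint i≢j X∈ Y∈ = below-M sumCard≤ (∈⇒card>0 𝓕 (𝓐⊑𝓕 i X X∈)) (begin
        D * (k * card 𝓦 + card 𝓤)     ≡⟨ cong (λ w → D * (k * w + card 𝓤)) 𝓦-empty ⟩
        D * (k * 0 + card 𝓤)          ≤⟨ *-monoʳ-≤ D (+-monoʳ-≤ (k * 0) 𝓤-bound) ⟩
        D * (k * 0 + 2 * (b * ℓ))     ≡⟨ regroup D k b ℓ ⟩
        2 * (b * (D * ℓ))             ≤⟨ *-mono-≤ 2≤d+1 (*-monoʳ-≤ b D*ℓ≤r*f) ⟩
        (d + 1) * (b * (r * f))       ≡⟨ collect (d + 1) b r f ⟩
        (d + 1) * (r * b) * f         ≤⟨ *-monoʳ-≤ ((d + 1) * (r * b)) (m≤n⊔m (k * ℓ) f) ⟩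
        (d + 1) * (r * b) * M         ∎)
        where
        2≤d+1 : 2 ≤ d + 1
        2≤d+1 = +-monoˡ-≤ 1 (m<n⇒0<n∸m (t<r i≢j X∈ Y∈))

        𝓦-empty : card 𝓦 ≡ 0
        𝓦-empty = trans (card-cong {𝓑 = emptyFamily} 𝓦≐∅) (card-empty {n})
          where
          𝓦≐∅ : 𝓦 ≐ emptyFamily
          𝓦≐∅ Z with inTwo? Z
          ... | yes two = contradiction two (disjoint Z)
          ... | no _    = refl

        meeting : Subset n → Family n
        meeting V Z = 𝓤 Z ∧ does (t ≤? ∣ V ∩ Z ∣)

        meeting-bound : ∀ V → ∣ V ∣ ≤ r → card (meeting V) ≤ b * ℓ
        meeting-bound V ∣V∣≤r = card≤b*ℓ (meeting V) {V}
          (λ Z → 𝓤⊑𝓕 Z ∘ ∧-conicalˡ _ _) ∣V∣≤r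
          (λ Z Z∈ → does-sound (t ≤? ∣ V ∩ Z ∣) (∧-conicalʳ (𝓤 Z) _ Z∈))

        covered : ∀ Z → Z ∈F 𝓤 → ∃ λ V → V List.∈ X ∷ Y ∷ [] × Z ∈F meeting V
        covered Z Z∈ with meets-two i≢j X∈ Y∈ (does-sound (inSome? Z) Z∈)
        ... | inj₁ t≤ = X , here refl , cong₂ _∧_ Z∈ (dec-true (t ≤? ∣ X ∩ Z ∣) t≤)
        ... | inj₂ t≤ = Y , there (here refl) , cong₂ _∧_ Z∈ (dec-true (t ≤? ∣ Y ∩ Z ∣) t≤)

        𝓤-bound : card 𝓤 ≤ 2 * (b * ℓ)
        𝓤-bound = ≤-trans (card-cover 𝓤 (X ∷ Y ∷ []) meeting covered)
          (+-mono-≤ (meeting-bound X (∈𝓕⇒size≤r (𝓐⊑𝓕 i X X∈)))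
            (+-monoˡ-≤ 0 (meeting-bound Y (∈𝓕⇒size≤r (𝓐⊑𝓕 j Y Y∈)))))

        regroup : ∀ D k b ℓ → D * (k * 0 + 2 * (b * ℓ)) ≡ 2 * (b * (D * ℓ))
        regroup = solve-∀
        collect : ∀ c b r f → c * (b * (r * f)) ≡ c * (r * b) * f
        collect = solve-∀

      sum<M : ∀ {i j X Y} → i ≢ j → X ∈F 𝓐 i → Y ∈F 𝓐 j → sumCard 𝓐 < M
      sum<M i≢j X∈ Y∈ with anySubset? inTwo?
      ... | yes (_ , two) = sum<M-overlapping two
      ... | no  ¬two      = sum<M-disjoint (λ Z two → ¬two (Z , two)) i≢j X∈ Y∈

    -- The possible shapes and the case of equality.

    data Shape : Set where
      concentrated : ∀ j → (∀ i → i ≢ j → 𝓐 i ≐ emptyFamily) → Shape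
      within-star  : ∀ T′ → ∣ T′ ∣ ≡ t → (∀ i → 𝓐 i ⊑ star 𝓕 T′) → Shape
      small        : sumCard 𝓐 < M → Shape

    -- At most one nonempty family is the concentrated case. With two nonempty families, either some
    -- `t`-set lies in all sets of the union, or `sum<M` applies.
    shape : 1 ≤ k → Shape
    shape 1≤k with Fin.any? (λ i → Fin.any? λ j → ¬? (i Fin.≟ j) ×-dec nonempty i ×-dec nonempty j)
      where
      nonempty : ∀ i → Dec (∃ λ X → X ∈F 𝓐 i)
      nonempty i = anySubset? λ X → 𝓐 i X Bool.≟ true
    shape 1≤k | yes (i , j , i≢j , (X , X∈) , (Y , Y∈))
      with anySubset? (λ T′ → (∣ T′ ∣ ≟ t) ×-dec ¬? (anySubset? (λ Z → inSome? Z ×-dec ¬? (T′ ⊆? Z))))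
    ... | yes (T′ , ∣T′∣≡t , ¬escape) = within-star T′ ∣T′∣≡t λ l Z Z∈ →
      ∈-star⁺ {𝓕 = 𝓕} (𝓐⊑𝓕 l Z Z∈)
        (decidable-stable (T′ ⊆? Z) λ T′⊈Z → ¬escape (Z , (l , Z∈) , T′⊈Z))
    ... | no ¬star = small (sum<M (λ T′ ∣T′∣≡t →
        decidable-stable (anySubset? (λ Z → inSome? Z ×-dec ¬? (T′ ⊆? Z)))
          λ ¬escape → ¬star (T′ , ∣T′∣≡t , ¬escape)) i≢j X∈ Y∈)
    shape (s≤s z≤n) | no ¬two with Fin.any? (λ i → anySubset? λ X → 𝓐 i X Bool.≟ true)
    ... | yes (j , Y) = concentrated j λ i i≢j X → ¬-not λ X∈ → ¬two (i , j , i≢j , (X , X∈) , Y)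
    -- All families are empty, so any index serves; `1 ≤ k` provides `zero`.
    ... | no ¬one     = concentrated zero λ i _ X → ¬-not λ X∈ → ¬one (i , X , X∈)

    sumCard-concentrated : ∀ {j} → (∀ i → i ≢ j → 𝓐 i ≐ emptyFamily) → sumCard 𝓐 ≡ card (𝓐 j)
    sumCard-concentrated {j} rest-empty = ∑-single (allFin⁺ k) (∈-allFin j)
      λ i i≢j → trans (card-cong {𝓑 = emptyFamily} (rest-empty i i≢j)) (card-empty {n})

    ∑-allFin-const : ∀ c → ∑ (allFin k) (λ _ → c) ≡ k * c
    ∑-allFin-const c = trans (∑-const c (allFin k)) (cong (_* c) (length-allFin k))

    sumCard-within-star : ∀ T′ → ∣ T′ ∣ ≡ t → (∀ i → 𝓐 i ⊑ star 𝓕 T′) → sumCard 𝓐 ≤ k * ℓ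
    sumCard-within-star T′ ∣T′∣≡t 𝓐⊑star = begin
      sumCard 𝓐                ≤⟨ ∑-mono (λ i → ≤-trans (card-mono (𝓐⊑star i)) (ℓ-max T′ ∣T′∣≡t)) (allFin k) ⟩
      ∑ (allFin k) (λ _ → ℓ)   ≡⟨ ∑-allFin-const ℓ ⟩
      k * ℓ                    ∎

    -- `ℓ` is measured at `T`, the families at `T′`; the maximality of each star gives one of the
    -- two inequalities.
    sumCard-all-star : AllEqualLargestStar t 𝓕 𝓐 → sumCard 𝓐 ≡ k * ℓ
    sumCard-all-star (T′ , (∣T′∣≡t , T′-max) , 𝓐≐star) = ≤-antisym
      (sumCard-within-star T′ ∣T′∣≡t λ i X → trans (sym (𝓐≐star i X)))
      (begin
        k * ℓ                    ≡⟨ ∑-allFin-const ℓ ⟨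
        ∑ (allFin k) (λ _ → ℓ)
          ≤⟨ ∑-mono (λ i → ≤-trans (T′-max T (proj₁ T-largest)) (≤-reflexive (sym (card-cong (𝓐≐star i))))) (allFin k) ⟩
        sumCard 𝓐                ∎)

    sumCard-one-full : OneFullRestEmpty 𝓕 𝓐 → sumCard 𝓐 ≡ f
    sumCard-one-full (j , 𝓐j≐𝓕 , rest-empty) = trans (sumCard-concentrated rest-empty) (card-cong 𝓐j≐𝓕)

    sumCard≤M : 1 ≤ k → sumCard 𝓐 ≤ M
    sumCard≤M 1≤k with shape 1≤k
    ... | concentrated j rest-empty    = ≤-trans (≤-reflexive (sumCard-concentrated rest-empty))
                                           (≤-trans (card-mono (𝓐⊑𝓕 j)) (m≤n⊔m (k * ℓ) f))
    ... | within-star T′ ∣T′∣≡t 𝓐⊑star = ≤-trans (sumCard-within-star T′ ∣T′∣≡t 𝓐⊑star) (m≤m⊔n (k * ℓ) f)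
    ... | small sum<                   = <⇒≤ sum<

    -- In the two non-strict shapes the sum is at most `f` or at most `k * ℓ`, so that number must
    -- equal `M`. The inclusions behind the bound then have full cardinality and become equalities.
    extremal : 1 ≤ k → sumCard 𝓐 ≡ M →
               (f ≤ k * ℓ × AllEqualLargestStar t 𝓕 𝓐) ⊎ (k * ℓ ≤ f × OneFullRestEmpty 𝓕 𝓐)
    extremal 1≤k sum≡M with shape 1≤k
    ... | small sum< = contradiction sum≡M (<⇒≢ sum<)
    ... | concentrated j rest-empty = inj₂
      ( ≤-trans (m≤m⊔n (k * ℓ) f) (≤-trans M≤card (card-mono (𝓐⊑𝓕 j)))
      , j , ⊑∧card≥⇒≐ (𝓐⊑𝓕 j) (≤-trans (m≤n⊔m (k * ℓ) f) M≤card) , rest-empty)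
      where
      M≤card : M ≤ card (𝓐 j)
      M≤card = ≤-reflexive (trans (sym sum≡M) (sumCard-concentrated rest-empty))
    ... | within-star T′ ∣T′∣≡t 𝓐⊑star = inj₁
      ( ≤-trans (m≤n⊔m (k * ℓ) f) (≤-trans (≤-reflexive (sym sum≡M)) (sumCard-within-star T′ ∣T′∣≡t 𝓐⊑star))
      , T′ , (∣T′∣≡t , T′-max) , λ i → ⊑∧card≥⇒≐ (𝓐⊑star i) (≤-trans (ℓ-max T′ ∣T′∣≡t) (ℓ≤card i)))
      where
      ℓ≤card : ∀ i → ℓ ≤ card (𝓐 i)
      ℓ≤card i = ∑-squeeze (λ i → ≤-trans (card-mono (𝓐⊑star i)) (ℓ-max T′ ∣T′∣≡t)) (allFin k)
        (≤-trans (≤-reflexive (∑-allFin-const ℓ)) (≤-trans (m≤m⊔n (k * ℓ) f) (≤-reflexive (sym sum≡M))))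
        (∈-allFin i)
      -- Some family exists because `1 ≤ k`; it has at least `ℓ` members, all inside the star of
      -- `T′`.
      T′-max : ∀ T″ → ∣ T″ ∣ ≡ t → card (star 𝓕 T″) ≤ card (star 𝓕 T′)
      T′-max T″ ∣T″∣≡t = ≤-trans (ℓ-max T″ ∣T″∣≡t)
        (≤-trans (ℓ≤card (fromℕ< 1≤k)) (card-mono (𝓐⊑star (fromℕ< 1≤k))))

theorem2p1 : (t r k n : ℕ) → 1 ≤ t → t ≤ r → 1 ≤ k →
    (𝓗 : Family n) → Hereditary 𝓗 → μ≥ 𝓗 (nS r t) →
    (S : ℕ → Bool) → Σ ℕ (λ s → S s ≡ true) →
    (∀ s → S s ≡ true → t ≤ s × s ≤ r) →
    (𝓐 : Fin k → Family n) → (∀ i → 𝓐 i ⊑ unionLevels 𝓗 S) →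
    CrossTIntersecting t 𝓐 →
    (T : Subset n) → IsLargestStar t (unionLevels 𝓗 S) T →
    (sumCard 𝓐 ≤ (k * card (star (unionLevels 𝓗 S) T)) ⊔ card (unionLevels 𝓗 S))
    × (sumCard 𝓐 ≡ (k * card (star (unionLevels 𝓗 S) T)) ⊔ card (unionLevels 𝓗 S)
    ⇔ ((card (unionLevels 𝓗 S) < k * card (star (unionLevels 𝓗 S) T)
    × AllEqualLargestStar t (unionLevels 𝓗 S) 𝓐)
    ⊎ ((k * card (star (unionLevels 𝓗 S) T) < card (unionLevels 𝓗 S)
    × OneFullRestEmpty (unionLevels 𝓗 S) 𝓐)
    ⊎ (card (unionLevels 𝓗 S) ≡ k * card (star (unionLevels 𝓗 S) T)
    × (AllEqualLargestStar t (unionLevels 𝓗 S) 𝓐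
    ⊎ OneFullRestEmpty (unionLevels 𝓗 S) 𝓐)))))
theorem2p1 t r k n 1≤t t≤r 1≤k 𝓗 hereditary μ≥nS S _ S⊆[t,r] 𝓐 𝓐⊑𝓕 cross T T-largest =
  sumCard≤M 1≤k , mk⇔ (classify ∘ extremal 1≤k) attained
  where
  open Hereditary-levels t r 1≤t 𝓗 hereditary μ≥nS S S⊆[t,r] T T-largest
  open Cross-intersecting 𝓐 𝓐⊑𝓕 cross

  Cases : Set
  Cases = (f < k * ℓ × AllEqualLargestStar t 𝓕 𝓐)
        ⊎ ((k * ℓ < f × OneFullRestEmpty 𝓕 𝓐)
        ⊎ (f ≡ k * ℓ × (AllEqualLargestStar t 𝓕 𝓐 ⊎ OneFullRestEmpty 𝓕 𝓐)))

  -- Splitting each weak inequality separates the strict cases (i) and (ii) from the tie (iii).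
  classify : (f ≤ k * ℓ × AllEqualLargestStar t 𝓕 𝓐) ⊎ (k * ℓ ≤ f × OneFullRestEmpty 𝓕 𝓐) → Cases
  classify (inj₁ (f≤kℓ , eq)) =
    [ (λ f<kℓ → inj₁ (f<kℓ , eq)) , (λ f≡kℓ → inj₂ (inj₂ (f≡kℓ , inj₁ eq))) ]′ (m≤n⇒m<n∨m≡n f≤kℓ)
  classify (inj₂ (kℓ≤f , eq)) =
    [ (λ kℓ<f → inj₂ (inj₁ (kℓ<f , eq))) , (λ kℓ≡f → inj₂ (inj₂ (sym kℓ≡f , inj₂ eq))) ]′ (m≤n⇒m<n∨m≡n kℓ≤f)

  attained : Cases → sumCard 𝓐 ≡ M
  attained (inj₁ (f<kℓ , eq))               = trans (sumCard-all-star eq) (sym (m≥n⇒m⊔n≡m (<⇒≤ f<kℓ)))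
  attained (inj₂ (inj₁ (kℓ<f , eq)))        = trans (sumCard-one-full eq) (sym (m≤n⇒m⊔n≡n (<⇒≤ kℓ<f)))
  attained (inj₂ (inj₂ (f≡kℓ , inj₁ eq)))   = trans (sumCard-all-star eq) (sym (m≥n⇒m⊔n≡m (≤-reflexive f≡kℓ)))
  attained (inj₂ (inj₂ (f≡kℓ , inj₂ eq)))   = trans (sumCard-one-full eq) (sym (m≤n⇒m⊔n≡n (≤-reflexive (sym f≡kℓ))))
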